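{- For any positive integers $m$ and $n$, $$\gcd\left(\sum_{k=0}^{2n}(-1)^k\binom{2n}{k}^r:\ r=m,m+1,m+2,\ldots\right)=\binom{2n}{n}.$$
   Context: $\gcd(a_1,a_2,\ldots)$ denotes the greatest common divisor of the (infinitely many) integers $a_1,a_2,\ldots$, i.e. the nonnegative generator of the ideal of $\mathbb{Z}$ they generate. -}

module Defs where

open import Data.Fin.Base using (toℕ)
open import Data.Integer.Base using (ℤ; +_; 0ℤ; -1ℤ; _+_; _*_; _^_)
open import Data.Integer.Divisibility.Signed using (_∣_)
open import Data.Integer.Properties using (+-0-commutativeMonoid)
open import Data.Nat.Base as ℕ using (ℕ; suc)
open import Data.Nat.Combinatorics using (_C_)
open import Function.Bundles using (_⇔_)
open import Algebra.Properties.CommutativeMonoid.Sum +-0-commutativeMonoid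
  using (sum-syntax)

-- The ideal of ℤ generated by a (possibly infinite) sequence of integers.
data _∈⟨_⟩ : ℤ → (ℕ → ℤ) → Set where
  generator : ∀ {a} i → a i ∈⟨ a ⟩
  zero      : ∀ {a} → 0ℤ ∈⟨ a ⟩
  add       : ∀ {a x y} → x ∈⟨ a ⟩ → y ∈⟨ a ⟩ → (x + y) ∈⟨ a ⟩
  scale     : ∀ {a x} c → x ∈⟨ a ⟩ → (c * x) ∈⟨ a ⟩

-- The gcd of a sequence is the nonnegative generator of the ideal ⟨ a ⟩:
-- the multiples of d are exactly the elements of ⟨ a ⟩.  It is a relation
-- because the gcd of an arbitrary infinite sequence is not computable; it
-- determines d uniquely, as d ranges over ℕ.
IsGCD : (ℕ → ℤ) → ℕ → Set
IsGCD a d = ∀ x → x ∈⟨ a ⟩ ⇔ (+ d) ∣ x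

alternatingSum : ℕ → ℕ → ℤ
alternatingSum n r =
  ∑[ k < suc (2 ℕ.* n) ] ((-1ℤ ^ toℕ k) * (+ ((2 ℕ.* n) C toℕ k)) ^ r)

{-# OPTIONS --safe #-}
module Submission where

-- Put g(t) = C(2n, n+t) and let A be the lower triangular operator
-- (A f)(s) = Σ_{t≤n} C(s,t) g(t) f(t).  By trinomial revision and Vandermonde,
-- e_k(s) = C(s,k) C(n+s, k+s) is an eigenvector of A with eigenvalue g(k), and
-- n! δ₀ is an explicit combination of e_0, …, e_n on {0, …, n}.  Applying A^r and
-- evaluating at n gives  Σ_k (-1)^k C(2n,k)^{r+1} = (-1)^n (A^r δ₀)(n).  Since
-- A δ₀ = C(2n,n) 𝟏, every sum is divisible by C(2n,n), and the quotients are,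
-- up to sign, the numbers (A^r 𝟏)(n).
--
-- These have no common prime factor p, however large r is taken: modulo p only
-- the coordinates t with p ∤ g(t) matter, and on them A is triangular with unit
-- diagonal entries, so it is invertible there and 𝟏 is a combination of the A^r 𝟏
-- with r large; as g(n) = 1, the coordinate n is among them, and 𝟏(n) = 1.

open import Defs
open import Data.Nat using (ℕ; _+_; _*_; NonZero)
open import Data.Nat.Combinatorics using (_C_)
open import Data.Fin.Base using (toℕ)
open import Data.Integer.Base as ℤ using (ℤ; +_; 0ℤ; 1ℤ; -1ℤ)
open import Data.Integer.Divisibility.Signed
  using (_∣_; divides; ∣ᵤ⇒∣; ∣⇒∣ᵤ; _∣?_; ∣m∣n⇒∣m+n; ∣m∣n⇒∣m-n; ∣n⇒∣m*n; ∣m⇒∣m*n)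
import Data.Integer.Properties as ℤ
open import Data.Integer.Tactic.RingSolver using (solve-∀)
open import Data.List.Base using ([]; _∷_)
open import Data.List.Relation.Unary.All using (_∷_)
open import Data.Nat as ℕ using (zero; suc; _∸_; _≤_; _<_; z≤n; s≤s; _!)
open import Data.Nat.Combinatorics
  using (k>n⇒nCk≡0; nCk≡nC[n∸k]; nCn≡1; nCk≡n!/k![n-k]!; k![n∸k]!∣n!; nCk+nC[k+1]≡[n+1]C[k+1])
import Data.Nat.Divisibility as ℕ
open import Data.Nat.DivMod using (m/n*n≡m)
open import Data.Nat.GCD using (gcd; gcd-GCD; gcd[m,n]∣m; gcd[m,n]∣n; gcd[m,n]≢0; module Bézout)
open import Data.Nat.Induction using (Acc; acc; <-wellFounded)
open import Data.Nat.ListAction using (product)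
open import Data.Nat.Primality using (Prime; euclidsLemma; prime[2]; ¬prime[1])
open import Data.Nat.Primality.Factorisation using (factorise)
import Data.Nat.Properties as ℕ
open import Data.Nat.Tactic.RingSolver using () renaming (solve-∀ to solveℕ-∀)
open import Data.Product.Base using (_×_; _,_; ∃-syntax)
open import Data.Sum.Base using (inj₁; inj₂)
open import Function.Base using (_∘_)
open import Function.Bundles using (mk⇔)
open import Relation.Binary.Definitions using (tri<; tri≈; tri>)
open import Relation.Binary.PropositionalEquality
  using (_≡_; _≢_; refl; sym; trans; cong; cong₂; subst; module ≡-Reasoning)
open import Relation.Nullary using (¬_; yes; no; contradiction)
open import Algebra.Properties.Semiring.Sum ℤ.+-*-semiring
  using (sum-syntax; ∑-distrib-+; ∑-comm; *-distribˡ-sum)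

-- Finite sums

∑< : ℕ → (ℕ → ℤ) → ℤ
∑< n f = ∑[ k < n ] f (toℕ k)

∑<-cong : ∀ n {f h : ℕ → ℤ} → (∀ k → k < n → f k ≡ h k) → ∑< n f ≡ ∑< n h
∑<-cong zero    f≡h = refl
∑<-cong (suc n) f≡h = cong₂ ℤ._+_ (f≡h 0 (s≤s z≤n)) (∑<-cong n (λ k k<n → f≡h (suc k) (s≤s k<n)))

∑<-zero : ∀ n {f : ℕ → ℤ} → (∀ k → k < n → f k ≡ 0ℤ) → ∑< n f ≡ 0ℤ
∑<-zero zero    f≡0 = refl
∑<-zero (suc n) f≡0 = cong₂ ℤ._+_ (f≡0 0 (s≤s z≤n)) (∑<-zero n (λ k k<n → f≡0 (suc k) (s≤s k<n)))

∑<-+ : ∀ n (f h : ℕ → ℤ) → ∑< n (λ k → f k ℤ.+ h k) ≡ ∑< n f ℤ.+ ∑< n h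
∑<-+ n f h = ∑-distrib-+ {n} (f ∘ toℕ) (h ∘ toℕ)

∑<-* : ∀ n x (f : ℕ → ℤ) → ∑< n (λ k → x ℤ.* f k) ≡ x ℤ.* ∑< n f
∑<-* n x f = sym (*-distribˡ-sum {n} x (f ∘ toℕ))

∑<-swap : ∀ m n (f : ℕ → ℕ → ℤ) → ∑< m (λ i → ∑< n (f i)) ≡ ∑< n (λ j → ∑< m (λ i → f i j))
∑<-swap m n f = ∑-comm {m} {n} (λ i j → f (toℕ i) (toℕ j))

∑<-split : ∀ m n (f : ℕ → ℤ) → ∑< (m + n) f ≡ ∑< m f ℤ.+ ∑< n (λ k → f (m + k))
∑<-split zero    n f = sym (ℤ.+-identityˡ _)
∑<-split (suc m) n f = trans (cong (ℤ._+_ (f 0)) (∑<-split m n (f ∘ suc))) (sym (ℤ.+-assoc (f 0) _ _))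

∑<-snoc : ∀ n (f : ℕ → ℤ) → ∑< (suc n) f ≡ ∑< n f ℤ.+ f n
∑<-snoc zero    f = ℤ.+-comm (f 0) 0ℤ
∑<-snoc (suc n) f = trans (cong (ℤ._+_ (f 0)) (∑<-snoc n (f ∘ suc))) (sym (ℤ.+-assoc (f 0) _ _))

∑<-reverse : ∀ n (f : ℕ → ℤ) → ∑< n f ≡ ∑< n (λ k → f (n ∸ suc k))
∑<-reverse zero    f = refl
∑<-reverse (suc n) f = begin
  ∑< (suc n) f                           ≡⟨ ∑<-snoc n f ⟩
  ∑< n f ℤ.+ f n                         ≡⟨ ℤ.+-comm (∑< n f) (f n) ⟩
  f n ℤ.+ ∑< n f                         ≡⟨ cong (ℤ._+_ (f n)) (∑<-reverse n f) ⟩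
  f n ℤ.+ ∑< n (λ k → f (n ∸ suc k))     ∎
  where open ≡-Reasoning

∑<-∣ : ∀ d n {f : ℕ → ℤ} → (∀ k → k < n → d ∣ f k) → d ∣ ∑< n f
∑<-∣ d zero    d∣f = divides 0ℤ refl
∑<-∣ d (suc n) d∣f = ∣m∣n⇒∣m+n (d∣f 0 (s≤s z≤n)) (∑<-∣ d n (λ k k<n → d∣f (suc k) (s≤s k<n)))

∑<-∣-except : ∀ d n {f : ℕ → ℤ} t → t < n → (∀ k → k < n → k ≢ t → d ∣ f k) → d ∣ ∑< n f ℤ.- f t
∑<-∣-except d (suc n) {f} zero t<n d∣f =
  subst (d ∣_) (lemma (f 0) _) (∑<-∣ d n {f ∘ suc} (λ k k<n → d∣f (suc k) (s≤s k<n) (λ ())))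
  where
  lemma : ∀ x y → y ≡ x ℤ.+ y ℤ.- x
  lemma = solve-∀
∑<-∣-except d (suc n) {f} (suc t) (s≤s t<n) d∣f =
  subst (d ∣_) (sym (ℤ.+-assoc (f 0) _ _))
    (∣m∣n⇒∣m+n (d∣f 0 (s≤s z≤n) (λ ()))
      (∑<-∣-except d n {f ∘ suc} t t<n (λ k k<n k≢t → d∣f (suc k) (s≤s k<n) (k≢t ∘ ℕ.suc-injective))))

-- Binomial coefficients

b : ℕ → ℕ → ℤ
b n k = + (n C k)

b-zero : ∀ {n k} → n < k → b n k ≡ 0ℤ
b-zero n<k = cong +_ (k>n⇒nCk≡0 n<k)

b-pascal : ∀ n k → b (suc n) (suc k) ≡ b n k ℤ.+ b n (suc k)
b-pascal n k = sym (cong +_ (nCk+nC[k+1]≡[n+1]C[k+1] n k))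

b-sym : ∀ i j → b (i + j) i ≡ b (i + j) j
b-sym i j = cong +_ (trans (nCk≡nC[n∸k] (ℕ.m≤m+n i j)) (cong ((i + j) C_) (ℕ.m+n∸m≡n i j)))

C-factorial : ∀ i j → ((i + j) C i) * (i ! * j !) ≡ (i + j) !
C-factorial i j = subst (λ x → ((i + j) C i) * (i ! * x !) ≡ (i + j) !) (ℕ.m+n∸m≡n i j)
  (trans (cong (_* (i ! * (i + j ∸ i) !)) (nCk≡n!/k![n-k]! i≤i+j))
    (m/n*n≡m (k![n∸k]!∣n! i≤i+j)))
  where
  i≤i+j = ℕ.m≤m+n i j
  instance _ = ℕ._!*_!≢0 i (i + j ∸ i)

-- Both sides are the trinomial coefficient `(k+u+v)! / (k! u! v!)`; the proof clears this
-- denominator.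
C-revision-+ : ∀ k u v → ((k + (u + v)) C (k + u)) * ((k + u) C k) ≡ ((k + (u + v)) C k) * ((u + v) C u)
C-revision-+ k u v = ℕ.*-cancelʳ-≡ _ _ (k ! * u ! * v !) (begin
  N₁ * N₂ * (k ! * u ! * v !)          ≡⟨ lemma₁ N₁ N₂ (k !) (u !) (v !) ⟩
  N₁ * (N₂ * (k ! * u !) * v !)        ≡⟨ cong (λ x → N₁ * (x * v !)) (C-factorial k u) ⟩
  N₁ * ((k + u) ! * v !)               ≡⟨ cong (λ x → (x C (k + u)) * ((k + u) ! * v !)) (ℕ.+-assoc k u v) ⟨
  ((k + u + v) C (k + u)) * ((k + u) ! * v !) ≡⟨ C-factorial (k + u) v ⟩
  (k + u + v) !                        ≡⟨ cong _! (ℕ.+-assoc k u v) ⟩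
  (k + (u + v)) !                      ≡⟨ C-factorial k (u + v) ⟨
  N₃ * (k ! * (u + v) !)               ≡⟨ cong (λ x → N₃ * (k ! * x)) (C-factorial u v) ⟨
  N₃ * (k ! * (N₄ * (u ! * v !)))      ≡⟨ lemma₂ N₃ N₄ (k !) (u !) (v !) ⟩
  N₃ * N₄ * (k ! * u ! * v !)          ∎)
  where
  open ≡-Reasoning
  N₁ = (k + (u + v)) C (k + u)
  N₂ = (k + u) C k
  N₃ = (k + (u + v)) C k
  N₄ = (u + v) C u
  instance
    _ = ℕ._!*_!≢0 k u
    _ = ℕ._!≢0 v
    _ = ℕ.m*n≢0 (k ! * u !) (v !)
  lemma₁ : ∀ a b x y z → a * b * (x * y * z) ≡ a * (b * (x * y) * z)
  lemma₁ = solveℕ-∀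
  lemma₂ : ∀ a b x y z → a * (x * (b * (y * z))) ≡ a * b * (x * y * z)
  lemma₂ = solveℕ-∀

-- Trinomial revision without a range condition: if `s < k + u`, both sides vanish, the right one
-- through `b s k` when `s < k` and through `b (s ∸ k) u` otherwise.
b-revision : ∀ s k u → b s (k + u) ℤ.* b (k + u) k ≡ b s k ℤ.* b (s ∸ k) u
b-revision s k u with (k + u) ℕ.≤? s
... | yes k+u≤s = begin
  b s (k + u) ℤ.* b (k + u) k      ≡⟨ cong (λ x → b x (k + u) ℤ.* b (k + u) k) s≡ ⟩
  b s′ (k + u) ℤ.* b (k + u) k     ≡⟨ ℤ.pos-* (s′ C (k + u)) ((k + u) C k) ⟨
  + ((s′ C (k + u)) * ((k + u) C k)) ≡⟨ cong +_ (C-revision-+ k u v) ⟩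
  + ((s′ C k) * ((u + v) C u))     ≡⟨ ℤ.pos-* (s′ C k) ((u + v) C u) ⟩
  b s′ k ℤ.* b (u + v) u           ≡⟨ cong₂ (λ x y → b x k ℤ.* b y u) s≡ (trans (cong (_∸ k) s≡) (ℕ.m+n∸m≡n k (u + v))) ⟨
  b s k ℤ.* b (s ∸ k) u            ∎
  where
  open ≡-Reasoning
  v  = s ∸ (k + u)
  s′ = k + (u + v)
  s≡ : s ≡ s′
  s≡ = trans (sym (ℕ.m+[n∸m]≡n k+u≤s)) (ℕ.+-assoc k u v)
... | no k+u≰s = trans (cong (ℤ._* b (k + u) k) (b-zero s<k+u)) (sym rhs≡0)
  where
  s<k+u = ℕ.≰⇒> k+u≰s
  rhs≡0 : b s k ℤ.* b (s ∸ k) u ≡ 0ℤ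
  rhs≡0 with k ℕ.≤? s
  ... | no  k≰s = cong (ℤ._* b (s ∸ k) u) (b-zero (ℕ.≰⇒> k≰s))
  ... | yes k≤s = trans (cong (b s k ℤ.*_) (b-zero
          (ℕ.+-cancelˡ-< k (s ∸ k) u (subst (_< k + u) (sym (ℕ.m+[n∸m]≡n k≤s)) s<k+u)))) (ℤ.*-zeroʳ (b s k))

-- Induction on `a`: Pascal's rule on `b (suc a) u` splits the sum, and Pascal's rule on row `m`
-- recombines the two halves into the sum for `a`, `suc m`, `suc c`. The bound on `B` ensures that
-- no nonzero term is cut off.
b-vandermonde : ∀ a m c B → m < c + B → ∑< B (λ u → b a u ℤ.* b m (c + u)) ≡ b (a + m) (a + c)
b-vandermonde zero m c zero m<c+B =
  sym (b-zero (subst (m <_) (ℕ.+-identityʳ c) m<c+B))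
b-vandermonde zero m c (suc B) m<c+B = begin
  1ℤ ℤ.* b m (c + 0) ℤ.+ ∑< B (λ u → b 0 (suc u) ℤ.* b m (c + suc u))
    ≡⟨ cong₂ ℤ._+_ (trans (ℤ.*-identityˡ _) (cong (b m) (ℕ.+-identityʳ c)))
                   (∑<-zero B (λ u _ → cong (ℤ._* b m (c + suc u)) (b-zero {0} {suc u} (s≤s z≤n)))) ⟩
  b m c ℤ.+ 0ℤ                             ≡⟨ ℤ.+-identityʳ (b m c) ⟩
  b m c                                    ∎
  where open ≡-Reasoning
b-vandermonde (suc a) m c zero m<c+B =
  sym (b-zero (s≤s (ℕ.+-monoʳ-< a (subst (m <_) (ℕ.+-identityʳ c) m<c+B))))
b-vandermonde (suc a) m c (suc B) m<c+B = begin
  ∑< (suc B) (λ u → b (suc a) u ℤ.* b m (c + u))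
    ≡⟨⟩
  b (suc a) 0 ℤ.* b m (c + 0) ℤ.+ ∑< B (λ u → b (suc a) (suc u) ℤ.* b m (c + suc u))
    ≡⟨ cong (ℤ._+_ (b (suc a) 0 ℤ.* b m (c + 0)))
         (trans (∑<-cong B (λ u _ → trans (cong (ℤ._* b m (c + suc u)) (b-pascal a u))
                                        (ℤ.*-distribʳ-+ (b m (c + suc u)) (b a u) (b a (suc u)))))
                (∑<-+ B (λ u → b a u ℤ.* b m (c + suc u)) (λ u → b a (suc u) ℤ.* b m (c + suc u)))) ⟩
  b a 0 ℤ.* b m (c + 0) ℤ.+ (X ℤ.+ Y)
    ≡⟨ rearrange (b a 0 ℤ.* b m (c + 0)) X Y ⟩
  (b a 0 ℤ.* b m (c + 0) ℤ.+ Y) ℤ.+ (X ℤ.+ 0ℤ)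
    ≡⟨ cong (ℤ._+_ (b a 0 ℤ.* b m (c + 0) ℤ.+ Y)) extend ⟩
  ∑< (suc B) (λ u → b a u ℤ.* b m (c + u)) ℤ.+ ∑< (suc B) (λ u → b a u ℤ.* b m (c + suc u))
    ≡⟨ ∑<-+ (suc B) (λ u → b a u ℤ.* b m (c + u)) (λ u → b a u ℤ.* b m (c + suc u)) ⟨
  ∑< (suc B) (λ u → b a u ℤ.* b m (c + u) ℤ.+ b a u ℤ.* b m (c + suc u))
    ≡⟨ ∑<-cong (suc B) (λ u _ → trans (sym (ℤ.*-distribˡ-+ (b a u) (b m (c + u)) (b m (c + suc u)))) (cong (b a u ℤ.*_)
         (trans (cong (λ x → b m (c + u) ℤ.+ b m x) (ℕ.+-suc c u)) (sym (b-pascal m (c + u)))))) ⟩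
  ∑< (suc B) (λ u → b a u ℤ.* b (suc m) (suc c + u))
    ≡⟨ b-vandermonde a (suc m) (suc c) (suc B) (s≤s m<c+B) ⟩
  b (a + suc m) (a + suc c)
    ≡⟨ cong₂ b (ℕ.+-suc a m) (ℕ.+-suc a c) ⟩
  b (suc a + m) (suc a + c) ∎
  where
  open ≡-Reasoning
  X = ∑< B (λ u → b a u ℤ.* b m (c + suc u))
  Y = ∑< B (λ u → b a (suc u) ℤ.* b m (c + suc u))
  rearrange : ∀ x y z → x ℤ.+ (y ℤ.+ z) ≡ (x ℤ.+ z) ℤ.+ (y ℤ.+ 0ℤ)
  rearrange = solve-∀
  -- The added top term `u = B` contains `b m (c + suc B)`, which is zero by the bound.
  extend : X ℤ.+ 0ℤ ≡ ∑< (suc B) (λ u → b a u ℤ.* b m (c + suc u))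
  extend = sym (trans (∑<-snoc B (λ u → b a u ℤ.* b m (c + suc u)))
    (cong (ℤ._+_ X) (trans (cong (b a B ℤ.*_) (b-zero m<c+B)) (ℤ.*-zeroʳ (b a B)))))

-- The transfer operator and its eigenvectors

g : ℕ → ℕ → ℤ
g n t = b (2 * n) (n + t)

A : ℕ → (ℕ → ℤ) → (ℕ → ℤ)
A n f s = ∑< (suc n) (λ t → b s t ℤ.* (g n t ℤ.* f t))

-- `A` is applied innermost, so `pow n (suc j) f` unfolds to `pow n j (A n f)`; this makes `K-A`
-- below immediate.
pow : ℕ → ℕ → (ℕ → ℤ) → (ℕ → ℤ)
pow n zero    f = f
pow n (suc r) f = pow n r (A n f)

lin : ℤ → (ℕ → ℤ) → ℤ → (ℕ → ℤ) → (ℕ → ℤ)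
lin x f y h i = x ℤ.* f i ℤ.+ y ℤ.* h i

A-cong : ∀ n {f h : ℕ → ℤ} → (∀ t → t ≤ n → f t ≡ h t) → ∀ s → A n f s ≡ A n h s
A-cong n f≡h s = ∑<-cong (suc n) (λ { t (s≤s t≤n) → cong (λ x → b s t ℤ.* (g n t ℤ.* x)) (f≡h t t≤n) })

-- `A` reads only the coordinates `t ≤ n`, so agreement there can replace equality of functions.
pow-cong : ∀ n r {f h : ℕ → ℤ} → (∀ t → t ≤ n → f t ≡ h t) → ∀ t → t ≤ n → pow n r f t ≡ pow n r h t
pow-cong n zero    f≡h = f≡h
pow-cong n (suc r) f≡h = pow-cong n r (λ t _ → A-cong n f≡h t)

A-lin : ∀ n x f y h s → A n (lin x f y h) s ≡ lin x (A n f) y (A n h) s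
A-lin n x f y h s = begin
  A n (lin x f y h) s
    ≡⟨ ∑<-cong (suc n) (λ t _ → lemma (b s t) (g n t) x (f t) y (h t)) ⟩
  ∑< (suc n) (λ t → x ℤ.* F t ℤ.+ y ℤ.* H t)
    ≡⟨ ∑<-+ (suc n) (λ t → x ℤ.* F t) (λ t → y ℤ.* H t) ⟩
  ∑< (suc n) (λ t → x ℤ.* F t) ℤ.+ ∑< (suc n) (λ t → y ℤ.* H t)
    ≡⟨ cong₂ ℤ._+_ (∑<-* (suc n) x F) (∑<-* (suc n) y H) ⟩
  lin x (A n f) y (A n h) s ∎
  where
  open ≡-Reasoning
  F = λ t → b s t ℤ.* (g n t ℤ.* f t)
  H = λ t → b s t ℤ.* (g n t ℤ.* h t)
  lemma : ∀ p q x f y h → p ℤ.* (q ℤ.* (x ℤ.* f ℤ.+ y ℤ.* h)) ≡ x ℤ.* (p ℤ.* (q ℤ.* f)) ℤ.+ y ℤ.* (p ℤ.* (q ℤ.* h))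
  lemma = solve-∀

pow-lin : ∀ n r x f y h s → s ≤ n → pow n r (lin x f y h) s ≡ lin x (pow n r f) y (pow n r h) s
pow-lin n zero    x f y h s s≤n = refl
pow-lin n (suc r) x f y h s s≤n =
  trans (pow-cong n r (λ t _ → A-lin n x f y h t) s s≤n) (pow-lin n r x (A n f) y (A n h) s s≤n)

pow-pow : ∀ n i j f → pow n j (pow n i f) ≡ pow n (i + j) f
pow-pow n zero    j f = refl
pow-pow n (suc i) j f = pow-pow n i j (A n f)

e : ℕ → ℕ → ℕ → ℤ
e n k s = b s k ℤ.* b (n + s) (k + s)

2*n≡n+n : ∀ n → 2 * n ≡ n + n
2*n≡n+n n = cong (_+_ n) (ℕ.+-identityʳ n)

-- Trinomial revision in row `2n` with the parts `n - k`, `k + t` and the rest, after passing to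
-- complementary lower indices. It frees the factor `g n k` from the summation index `t`.
g-revision : ∀ n k t → k ≤ n → g n t ℤ.* b (n + t) (k + t) ≡ g n k ℤ.* b (n + k) (k + t)
g-revision n k t k≤n = begin
  b N (n + t) ℤ.* b (n + t) (k + t)                    ≡⟨ cong (λ x → b N x ℤ.* b x (k + t)) n+t≡ ⟩
  b N (l + (k + t)) ℤ.* b (l + (k + t)) (k + t)        ≡⟨ cong (b N (l + (k + t)) ℤ.*_) (b-sym l (k + t)) ⟨
  b N (l + (k + t)) ℤ.* b (l + (k + t)) l              ≡⟨ b-revision N l (k + t) ⟩
  b N l ℤ.* b (N ∸ l) (k + t)                          ≡⟨ cong (λ x → b x l ℤ.* b (x ∸ l) (k + t)) N≡ ⟩
  b (l + (n + k)) l ℤ.* b (l + (n + k) ∸ l) (k + t)    ≡⟨ cong₂ (λ x y → x ℤ.* b y (k + t)) (b-sym l (n + k)) (ℕ.m+n∸m≡n l (n + k)) ⟩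
  b (l + (n + k)) (n + k) ℤ.* b (n + k) (k + t)        ≡⟨ cong (λ x → b x (n + k) ℤ.* b (n + k) (k + t)) N≡ ⟨
  b N (n + k) ℤ.* b (n + k) (k + t)                    ∎
  where
  open ≡-Reasoning
  N = 2 * n
  l = n ∸ k
  l+k≡n : l + k ≡ n
  l+k≡n = ℕ.m∸n+n≡m k≤n
  n+t≡ : n + t ≡ l + (k + t)
  n+t≡ = trans (cong (_+ t) (sym l+k≡n)) (ℕ.+-assoc l k t)
  N≡ : N ≡ l + (n + k)
  N≡ = trans (2*n≡n+n n) (trans (cong (_+_ n) (sym l+k≡n)) (lemma n l k))
    where
    lemma : ∀ n l k → n + (l + k) ≡ l + (n + k)
    lemma = solveℕ-∀

-- Terms with `t < k` contain `b t k = 0`. For `t = k + u` the two revisions pull out `g n k` and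
-- `b s k`, and Vandermonde sums the remaining products `b (s ∸ k) u * b (n + k) (2k + u)`.
A-eigenvector : ∀ n k → k ≤ n → ∀ s → A n (e n k) s ≡ g n k ℤ.* e n k s
A-eigenvector n k k≤n s = begin
  A n (e n k) s
    ≡⟨ ∑<-cong (suc n) (λ t _ → trans (lemma₁ (b s t) (g n t) (b t k) (b (n + t) (k + t)))
         (cong (b s t ℤ.* b t k ℤ.*_) (g-revision n k t k≤n))) ⟩
  ∑< (suc n) G
    ≡⟨ cong (λ x → ∑< x G) (trans (ℕ.+-suc k l) (cong suc (ℕ.m+[n∸m]≡n k≤n))) ⟨
  ∑< (k + suc l) G
    ≡⟨ ∑<-split k (suc l) G ⟩
  ∑< k G ℤ.+ ∑< (suc l) (λ u → G (k + u))
    ≡⟨ cong₂ ℤ._+_ (∑<-zero k below) (∑<-cong (suc l) (λ u _ → above u)) ⟩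
  0ℤ ℤ.+ ∑< (suc l) (λ u → (g n k ℤ.* b s k) ℤ.* (b (s ∸ k) u ℤ.* b (n + k) (k + k + u)))
    ≡⟨ ℤ.+-identityˡ _ ⟩
  ∑< (suc l) (λ u → (g n k ℤ.* b s k) ℤ.* (b (s ∸ k) u ℤ.* b (n + k) (k + k + u)))
    ≡⟨ ∑<-* (suc l) (g n k ℤ.* b s k) (λ u → b (s ∸ k) u ℤ.* b (n + k) (k + k + u)) ⟩
  (g n k ℤ.* b s k) ℤ.* ∑< (suc l) (λ u → b (s ∸ k) u ℤ.* b (n + k) (k + k + u))
    ≡⟨ cong ((g n k ℤ.* b s k) ℤ.*_) (b-vandermonde (s ∸ k) (n + k) (k + k) (suc l) n+k<) ⟩
  (g n k ℤ.* b s k) ℤ.* b (s ∸ k + (n + k)) (s ∸ k + (k + k))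
    ≡⟨ ℤ.*-assoc (g n k) (b s k) _ ⟩
  g n k ℤ.* (b s k ℤ.* b (s ∸ k + (n + k)) (s ∸ k + (k + k)))
    ≡⟨ cong (g n k ℤ.*_) tidy ⟩
  g n k ℤ.* e n k s ∎
  where
  open ≡-Reasoning
  l = n ∸ k
  G : ℕ → ℤ
  G t = b s t ℤ.* b t k ℤ.* (g n k ℤ.* b (n + k) (k + t))
  lemma₁ : ∀ x y z w → x ℤ.* (y ℤ.* (z ℤ.* w)) ≡ x ℤ.* z ℤ.* (y ℤ.* w)
  lemma₁ = solve-∀
  lemma₂ : ∀ x y z w → x ℤ.* y ℤ.* (z ℤ.* w) ≡ z ℤ.* x ℤ.* (y ℤ.* w)
  lemma₂ = solve-∀
  below : ∀ t → t < k → G t ≡ 0ℤ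
  below t t<k = trans (cong (λ x → b s t ℤ.* x ℤ.* (g n k ℤ.* b (n + k) (k + t))) (b-zero t<k))
                      (cong (ℤ._* (g n k ℤ.* b (n + k) (k + t))) (ℤ.*-zeroʳ (b s t)))
  above : ∀ u → G (k + u) ≡ (g n k ℤ.* b s k) ℤ.* (b (s ∸ k) u ℤ.* b (n + k) (k + k + u))
  above u = trans (cong₂ (λ x y → x ℤ.* (g n k ℤ.* b (n + k) y)) (b-revision s k u) (sym (ℕ.+-assoc k k u)))
                  (lemma₂ (b s k) (b (s ∸ k) u) (g n k) (b (n + k) (k + k + u)))
  -- Since `n + k = k + k + l`, the `suc l` available terms are just enough for Vandermonde.
  n+k< : n + k < k + k + suc l
  n+k< = ℕ.≤-reflexive (trans (cong (λ x → suc (x + k)) (sym (ℕ.m+[n∸m]≡n k≤n))) (lemma k l))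
    where
    lemma : ∀ k l → suc (k + l + k) ≡ k + k + suc l
    lemma = solveℕ-∀
  -- For `k > s` the truncated subtraction gives different binomials, but the common factor `b s k`
  -- is zero.
  tidy : b s k ℤ.* b (s ∸ k + (n + k)) (s ∸ k + (k + k)) ≡ e n k s
  tidy with k ℕ.≤? s
  ... | yes k≤s = cong (b s k ℤ.*_) (cong₂ b
        (trans (lemma (s ∸ k) n k) (cong (_+_ n) (ℕ.m∸n+n≡m k≤s)))
        (trans (lemma (s ∸ k) k k) (cong (_+_ k) (ℕ.m∸n+n≡m k≤s))))
    where
    lemma : ∀ x n k → x + (n + k) ≡ n + (x + k)
    lemma = solveℕ-∀
  ... | no  k≰s = trans (cong (ℤ._* b (s ∸ k + (n + k)) (s ∸ k + (k + k))) (b-zero (ℕ.≰⇒> k≰s)))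
                        (cong (ℤ._* b (n + s) (k + s)) (sym (b-zero (ℕ.≰⇒> k≰s))))

-- `N` is a common denominator that keeps the eigenvector coefficients of `f` integral.
A-spectral : ∀ n N f (a : ℕ → ℤ) → (∀ i → i ≤ n → N ℤ.* f i ≡ ∑< (suc n) (λ k → a k ℤ.* e n k i)) →
             ∀ s → N ℤ.* A n f s ≡ ∑< (suc n) (λ k → g n k ℤ.* a k ℤ.* e n k s)
A-spectral n N f a Nf≡ s = begin
  N ℤ.* A n f s
    ≡⟨ ∑<-* (suc n) N (λ t → b s t ℤ.* (g n t ℤ.* f t)) ⟨
  ∑< (suc n) (λ t → N ℤ.* (b s t ℤ.* (g n t ℤ.* f t)))
    ≡⟨ ∑<-cong (suc n) (λ { t (s≤s t≤n) → trans (lemma₁ N (b s t) (g n t) (f t))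
         (trans (cong (b s t ℤ.* g n t ℤ.*_) (Nf≡ t t≤n))
                (sym (∑<-* (suc n) (b s t ℤ.* g n t) (λ k → a k ℤ.* e n k t)))) }) ⟩
  ∑< (suc n) (λ t → ∑< (suc n) (λ k → b s t ℤ.* g n t ℤ.* (a k ℤ.* e n k t)))
    ≡⟨ ∑<-swap (suc n) (suc n) (λ t k → b s t ℤ.* g n t ℤ.* (a k ℤ.* e n k t)) ⟩
  ∑< (suc n) (λ k → ∑< (suc n) (λ t → b s t ℤ.* g n t ℤ.* (a k ℤ.* e n k t)))
    ≡⟨ ∑<-cong (suc n) (λ { k (s≤s k≤n) → eigen k k≤n }) ⟩
  ∑< (suc n) (λ k → g n k ℤ.* a k ℤ.* e n k s) ∎
  where
  open ≡-Reasoning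
  lemma₁ : ∀ x y z w → x ℤ.* (y ℤ.* (z ℤ.* w)) ≡ y ℤ.* z ℤ.* (x ℤ.* w)
  lemma₁ = solve-∀
  lemma₂ : ∀ x y z w → x ℤ.* y ℤ.* (z ℤ.* w) ≡ z ℤ.* (x ℤ.* (y ℤ.* w))
  lemma₂ = solve-∀
  lemma₃ : ∀ x y z → x ℤ.* (y ℤ.* z) ≡ y ℤ.* x ℤ.* z
  lemma₃ = solve-∀
  eigen : ∀ k → k ≤ n → ∑< (suc n) (λ t → b s t ℤ.* g n t ℤ.* (a k ℤ.* e n k t)) ≡ g n k ℤ.* a k ℤ.* e n k s
  eigen k k≤n = begin
    ∑< (suc n) (λ t → b s t ℤ.* g n t ℤ.* (a k ℤ.* e n k t))
      ≡⟨ ∑<-cong (suc n) (λ t _ → lemma₂ (b s t) (g n t) (a k) (e n k t)) ⟩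
    ∑< (suc n) (λ t → a k ℤ.* (b s t ℤ.* (g n t ℤ.* e n k t)))
      ≡⟨ ∑<-* (suc n) (a k) (λ t → b s t ℤ.* (g n t ℤ.* e n k t)) ⟩
    a k ℤ.* A n (e n k) s
      ≡⟨ cong (a k ℤ.*_) (A-eigenvector n k k≤n s) ⟩
    a k ℤ.* (g n k ℤ.* e n k s)
      ≡⟨ lemma₃ (a k) (g n k) (e n k s) ⟩
    g n k ℤ.* a k ℤ.* e n k s ∎

pow-spectral : ∀ n r N f (a : ℕ → ℤ) → (∀ i → i ≤ n → N ℤ.* f i ≡ ∑< (suc n) (λ k → a k ℤ.* e n k i)) →
               ∀ s → s ≤ n → N ℤ.* pow n r f s ≡ ∑< (suc n) (λ k → g n k ℤ.^ r ℤ.* a k ℤ.* e n k s)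
pow-spectral n zero N f a Nf≡ s s≤n =
  trans (Nf≡ s s≤n) (∑<-cong (suc n) (λ k _ → cong (ℤ._* e n k s) (sym (ℤ.*-identityˡ (a k)))))
pow-spectral n (suc r) N f a Nf≡ s s≤n =
  trans (pow-spectral n r N (A n f) (λ k → g n k ℤ.* a k) (λ i _ → A-spectral n N f a Nf≡ i) s s≤n)
        (∑<-cong (suc n) (λ k _ → cong (ℤ._* e n k s) (lemma (g n k ℤ.^ r) (g n k) (a k))))
  where
  lemma : ∀ x y z → x ℤ.* (y ℤ.* z) ≡ y ℤ.* x ℤ.* z
  lemma = solve-∀

-- Alternating sums

-- ε k is the weight (-1)^k of k in a sum over all integers, with ±k combined.
ε : ℕ → ℤ
ε zero    = 1ℤ
ε (suc k) = + 2 ℤ.* -1ℤ ℤ.^ suc k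

δ : ℕ → ℤ
δ zero    = 1ℤ
δ (suc _) = 0ℤ

-1^[k+k]≡1 : ∀ k → -1ℤ ℤ.^ (k + k) ≡ 1ℤ
-1^[k+k]≡1 zero    = refl
-1^[k+k]≡1 (suc k) = begin
  -1ℤ ℤ.^ suc (k + suc k)          ≡⟨ cong (λ x → -1ℤ ℤ.* -1ℤ ℤ.^ x) (ℕ.+-suc k k) ⟩
  -1ℤ ℤ.* (-1ℤ ℤ.* -1ℤ ℤ.^ (k + k)) ≡⟨ cong (λ x → -1ℤ ℤ.* (-1ℤ ℤ.* x)) (-1^[k+k]≡1 k) ⟩
  1ℤ ∎
  where open ≡-Reasoning

-- The sum is recentred at `n`; the terms at `n - k` and `n + k` have equal binomials and signs of
-- equal parity, so they combine into the weight `ε k`.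
alternatingSum-folded : ∀ n r → alternatingSum n r ≡ -1ℤ ℤ.^ n ℤ.* ∑< (suc n) (λ k → ε k ℤ.* g n k ℤ.^ r)
alternatingSum-folded n r = begin
  ∑< (suc (2 * n)) F
    ≡⟨ cong (λ x → ∑< x F) (trans (cong suc (2*n≡n+n n)) (sym (ℕ.+-suc n n))) ⟩
  ∑< (n + suc n) F
    ≡⟨ ∑<-split n (suc n) F ⟩
  ∑< n F ℤ.+ (F (n + 0) ℤ.+ ∑< n (λ k → F (n + suc k)))
    ≡⟨ cong (ℤ._+ (F (n + 0) ℤ.+ ∑< n (λ k → F (n + suc k))))
         (trans (∑<-reverse n F) (∑<-cong n F-symmetric)) ⟩
  X ℤ.+ (F (n + 0) ℤ.+ X)
    ≡⟨ rearrange X (F (n + 0)) ⟩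
  F (n + 0) ℤ.+ + 2 ℤ.* X
    ≡⟨ cong₂ ℤ._+_ (F-shift 0) (sym (∑<-* n (+ 2) (λ k → F (n + suc k)))) ⟩
  -1ℤ ℤ.^ n ℤ.* (1ℤ ℤ.* g n 0 ℤ.^ r) ℤ.+ ∑< n (λ k → + 2 ℤ.* F (n + suc k))
    ≡⟨ cong (ℤ._+_ (-1ℤ ℤ.^ n ℤ.* (1ℤ ℤ.* g n 0 ℤ.^ r))) (∑<-cong n (λ k _ →
         trans (cong (+ 2 ℤ.*_) (F-shift (suc k))) (lemma (+ 2) (-1ℤ ℤ.^ n) (-1ℤ ℤ.^ suc k) (g n (suc k) ℤ.^ r)))) ⟩
  -1ℤ ℤ.^ n ℤ.* (1ℤ ℤ.* g n 0 ℤ.^ r) ℤ.+ ∑< n (λ k → -1ℤ ℤ.^ n ℤ.* (ε (suc k) ℤ.* g n (suc k) ℤ.^ r))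
    ≡⟨ ∑<-* (suc n) (-1ℤ ℤ.^ n) (λ k → ε k ℤ.* g n k ℤ.^ r) ⟩
  -1ℤ ℤ.^ n ℤ.* ∑< (suc n) (λ k → ε k ℤ.* g n k ℤ.^ r) ∎
  where
  open ≡-Reasoning
  F : ℕ → ℤ
  F i = -1ℤ ℤ.^ i ℤ.* b (2 * n) i ℤ.^ r
  X = ∑< n (λ k → F (n + suc k))
  rearrange : ∀ x y → x ℤ.+ (y ℤ.+ x) ≡ y ℤ.+ + 2 ℤ.* x
  rearrange = solve-∀
  lemma : ∀ t x y z → t ℤ.* (x ℤ.* (y ℤ.* z)) ≡ x ℤ.* (t ℤ.* y ℤ.* z)
  lemma = solve-∀
  F-shift : ∀ k → F (n + k) ≡ -1ℤ ℤ.^ n ℤ.* (-1ℤ ℤ.^ k ℤ.* g n k ℤ.^ r)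
  F-shift k = trans (cong (ℤ._* g n k ℤ.^ r) (ℤ.^-distribˡ-+-* -1ℤ n k)) (ℤ.*-assoc (-1ℤ ℤ.^ n) _ _)
  F-symmetric : ∀ k → k < n → F (n ∸ suc k) ≡ F (n + suc k)
  F-symmetric k k<n = cong₂ (λ x y → x ℤ.* y ℤ.^ r) signs binomials
    where
    l = n ∸ suc k
    n≡ : n ≡ l + suc k
    n≡ = sym (ℕ.m∸n+n≡m k<n)
    signs : -1ℤ ℤ.^ l ≡ -1ℤ ℤ.^ (n + suc k)
    signs = begin
      -1ℤ ℤ.^ l                                 ≡⟨ ℤ.*-identityʳ _ ⟨
      -1ℤ ℤ.^ l ℤ.* 1ℤ                          ≡⟨ cong (-1ℤ ℤ.^ l ℤ.*_) (-1^[k+k]≡1 (suc k)) ⟨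
      -1ℤ ℤ.^ l ℤ.* -1ℤ ℤ.^ (suc k + suc k)     ≡⟨ ℤ.^-distribˡ-+-* -1ℤ l (suc k + suc k) ⟨
      -1ℤ ℤ.^ (l + (suc k + suc k))             ≡⟨ cong (-1ℤ ℤ.^_) (ℕ.+-assoc l (suc k) (suc k)) ⟨
      -1ℤ ℤ.^ (l + suc k + suc k)               ≡⟨ cong (λ x → -1ℤ ℤ.^ (x + suc k)) n≡ ⟨
      -1ℤ ℤ.^ (n + suc k)                       ∎
    2n≡ : 2 * n ≡ l + (n + suc k)
    2n≡ = trans (2*n≡n+n n) (trans (cong (_+_ n) n≡) (swap n l (suc k)))
      where
      swap : ∀ n l k → n + (l + k) ≡ l + (n + k)
      swap = solveℕ-∀
    binomials : b (2 * n) l ≡ b (2 * n) (n + suc k)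
    binomials = subst (λ x → b x l ≡ b x (n + suc k)) (sym 2n≡) (b-sym l (n + suc k))

-- Pascal's rule makes the partial sums telescope; the start is `C(2q+2, q+1) = 2 C(2q+1, q+1)`. The
-- right side vanishes once `K > q`, which gives the zeros of the delta function.
ε-binomial-partialSum : ∀ q K → ∑< (suc K) (λ k → ε k ℤ.* b (2 * suc q) (suc q + k)) ≡
                        + 2 ℤ.* -1ℤ ℤ.^ K ℤ.* b (q + suc q) (suc q + K)
ε-binomial-partialSum q K = subst (λ x → ∑< (suc K) (λ k → ε k ℤ.* b (suc x) (suc q + k)) ≡
                        + 2 ℤ.* -1ℤ ℤ.^ K ℤ.* b p (suc q + K)) (cong (_+_ q) (sym (ℕ.+-identityʳ (suc q)))) (go K)
  where
  open ≡-Reasoning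
  p = q + suc q
  go : ∀ K → ∑< (suc K) (λ k → ε k ℤ.* b (suc p) (suc q + k)) ≡ + 2 ℤ.* -1ℤ ℤ.^ K ℤ.* b p (suc q + K)
  go zero = begin
    1ℤ ℤ.* b (suc p) (suc q + 0) ℤ.+ 0ℤ        ≡⟨ cong (λ x → 1ℤ ℤ.* x ℤ.+ 0ℤ) (b-pascal p (q + 0)) ⟩
    1ℤ ℤ.* (b p (q + 0) ℤ.+ b p (suc q + 0)) ℤ.+ 0ℤ
      ≡⟨ cong (λ x → 1ℤ ℤ.* (x ℤ.+ b p (suc q + 0)) ℤ.+ 0ℤ)
           (subst (λ x → b p x ≡ b p (suc x)) (sym (ℕ.+-identityʳ q)) (b-sym q (suc q))) ⟩
    1ℤ ℤ.* (b p (suc q + 0) ℤ.+ b p (suc q + 0)) ℤ.+ 0ℤ ≡⟨ lemma (b p (suc q + 0)) ⟩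
    + 2 ℤ.* 1ℤ ℤ.* b p (suc q + 0) ∎
    where
    lemma : ∀ x → 1ℤ ℤ.* (x ℤ.+ x) ℤ.+ 0ℤ ≡ + 2 ℤ.* 1ℤ ℤ.* x
    lemma = solve-∀
  go (suc K) = begin
    ∑< (suc (suc K)) (λ k → ε k ℤ.* b (suc p) (suc q + k))
      ≡⟨ ∑<-snoc (suc K) (λ k → ε k ℤ.* b (suc p) (suc q + k)) ⟩
    ∑< (suc K) (λ k → ε k ℤ.* b (suc p) (suc q + k)) ℤ.+ ε (suc K) ℤ.* b (suc p) (suc q + suc K)
      ≡⟨ cong₂ ℤ._+_ (go K) (cong (ε (suc K) ℤ.*_) (trans (b-pascal p (q + suc K))
           (cong (λ x → b p x ℤ.+ b p (suc q + suc K)) (ℕ.+-suc q K)))) ⟩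
    + 2 ℤ.* -1ℤ ℤ.^ K ℤ.* b p (suc q + K) ℤ.+
      + 2 ℤ.* (-1ℤ ℤ.* -1ℤ ℤ.^ K) ℤ.* (b p (suc q + K) ℤ.+ b p (suc q + suc K))
      ≡⟨ lemma (-1ℤ ℤ.^ K) (b p (suc q + K)) (b p (suc q + suc K)) ⟩
    + 2 ℤ.* -1ℤ ℤ.^ suc K ℤ.* b p (suc q + suc K) ∎
    where
    lemma : ∀ x y z → + 2 ℤ.* x ℤ.* y ℤ.+ + 2 ℤ.* (-1ℤ ℤ.* x) ℤ.* (y ℤ.+ z) ≡ + 2 ℤ.* (-1ℤ ℤ.* x) ℤ.* z
    lemma = solve-∀

-- Expansion of the delta function in eigenvectors

fact : ℕ → ℤ
fact n = + (n !)

b-factorial : ∀ {i j m} → m ≡ i + j → b m i ℤ.* (fact i ℤ.* fact j) ≡ fact m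
b-factorial {i} {j} refl = begin
  b (i + j) i ℤ.* (fact i ℤ.* fact j)     ≡⟨ cong (b (i + j) i ℤ.*_) (ℤ.pos-* (i !) (j !)) ⟨
  b (i + j) i ℤ.* + (i ! * j !)           ≡⟨ ℤ.pos-* ((i + j) C i) (i ! * j !) ⟨
  + (((i + j) C i) * (i ! * j !))         ≡⟨ cong +_ (C-factorial i j) ⟩
  fact (i + j)                            ∎
  where open ≡-Reasoning

-- The coefficient of (-1)^k e_k in δ₀ is 1 / C(n,k); multiplying by n! clears it to k! (n-k)!.
d : ℕ → ℕ → ℤ
d n k = fact k ℤ.* fact (n ∸ k)

-- For `k ≤ i`, cancelling factorials gives `d n k * e n k i = i! (n+i)! / ((i-k)!
-- (i+k)!)`. After scaling by `(2i)!` the index `k` survives only in one binomial of row `2i`, whose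
-- ε-weighted sum is known.
e-scaled : ∀ n k i → k ≤ n → fact (2 * i) ℤ.* (d n k ℤ.* e n k i) ≡ fact i ℤ.* fact (n + i) ℤ.* b (2 * i) (i + k)
e-scaled n k i k≤n with k ℕ.≤? i
... | yes k≤i = begin
  fact (2 * i) ℤ.* (d n k ℤ.* e n k i)
    ≡⟨ cong (ℤ._* (d n k ℤ.* e n k i)) (b-factorial {i + k} {v} 2i≡) ⟨
  b (2 * i) (i + k) ℤ.* (fact (i + k) ℤ.* fact v) ℤ.* (d n k ℤ.* e n k i)
    ≡⟨ cong (λ x → b (2 * i) (i + k) ℤ.* (fact x ℤ.* fact v) ℤ.* (d n k ℤ.* e n k i)) (ℕ.+-comm i k) ⟩
  b (2 * i) (i + k) ℤ.* (fact (k + i) ℤ.* fact v) ℤ.* (fact k ℤ.* fact l ℤ.* (b i k ℤ.* b (n + i) (k + i)))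
    ≡⟨ lemma (b (2 * i) (i + k)) (fact (k + i)) (fact v) (fact k) (fact l) (b i k) (b (n + i) (k + i)) ⟩
  b i k ℤ.* (fact k ℤ.* fact v) ℤ.* (b (n + i) (k + i) ℤ.* (fact (k + i) ℤ.* fact l)) ℤ.* b (2 * i) (i + k)
    ≡⟨ cong₂ (λ x y → x ℤ.* y ℤ.* b (2 * i) (i + k)) (b-factorial {k} {v} (sym k+v≡i)) (b-factorial {k + i} {l} n+i≡) ⟩
  fact i ℤ.* fact (n + i) ℤ.* b (2 * i) (i + k) ∎
  where
  open ≡-Reasoning
  v = i ∸ k
  l = n ∸ k
  k+v≡i : k + v ≡ i
  k+v≡i = ℕ.m+[n∸m]≡n k≤i
  2i≡ : 2 * i ≡ i + k + v
  2i≡ = trans (2*n≡n+n i) (trans (cong (_+_ i) (sym k+v≡i)) (sym (ℕ.+-assoc i k v)))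
  n+i≡ : n + i ≡ k + i + l
  n+i≡ = trans (cong (_+ i) (sym (ℕ.m+[n∸m]≡n k≤n))) (swap k l i)
    where
    swap : ∀ k l i → k + l + i ≡ k + i + l
    swap = solveℕ-∀
  lemma : ∀ x f v k l y z → x ℤ.* (f ℤ.* v) ℤ.* (k ℤ.* l ℤ.* (y ℤ.* z)) ≡ y ℤ.* (k ℤ.* v) ℤ.* (z ℤ.* (f ℤ.* l)) ℤ.* x
  lemma = solve-∀
... | no k≰i = trans
  (trans (cong (λ x → fact (2 * i) ℤ.* (d n k ℤ.* (x ℤ.* b (n + i) (k + i)))) (b-zero i<k))
         (lemma (fact (2 * i)) (d n k) (b (n + i) (k + i))))
  (sym (trans (cong (fact i ℤ.* fact (n + i) ℤ.*_) (b-zero (subst (_< i + k) (sym (2*n≡n+n i)) (ℕ.+-monoʳ-< i i<k))))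
              (ℤ.*-zeroʳ (fact i ℤ.* fact (n + i)))))
  where
  i<k = ℕ.≰⇒> k≰i
  lemma : ∀ x y z → x ℤ.* (y ℤ.* (0ℤ ℤ.* z)) ≡ 0ℤ
  lemma = solve-∀

-- At `i = 0` only `k = 0` contributes. For `i > 0` the sum, scaled by the nonzero `(2i)!`, is a
-- multiple of a complete alternating sum over row `2i`, hence zero.
δ-expansion : ∀ n i → i ≤ n → fact n ℤ.* δ i ≡ ∑< (suc n) (λ k → ε k ℤ.* d n k ℤ.* e n k i)
δ-expansion n zero i≤n = begin
  fact n ℤ.* 1ℤ                               ≡⟨ cong (ℤ._* 1ℤ) (b-factorial {0} {n} refl) ⟨
  1ℤ ℤ.* (1ℤ ℤ.* fact n) ℤ.* 1ℤ               ≡⟨ lemma (fact n) ⟩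
  1ℤ ℤ.* (1ℤ ℤ.* fact n) ℤ.* (1ℤ ℤ.* 1ℤ) ℤ.+ 0ℤ
    ≡⟨ cong (ℤ._+_ (ε 0 ℤ.* d n 0 ℤ.* e n 0 0)) (∑<-zero n (λ k _ →
         trans (cong (λ x → ε (suc k) ℤ.* d n (suc k) ℤ.* (x ℤ.* b (n + 0) (suc k + 0))) (b-zero {0} {suc k} (s≤s z≤n)))
               (ℤ.*-zeroʳ (ε (suc k) ℤ.* d n (suc k))))) ⟨
  ∑< (suc n) (λ k → ε k ℤ.* d n k ℤ.* e n k 0) ∎
  where
  open ≡-Reasoning
  lemma : ∀ x → 1ℤ ℤ.* (1ℤ ℤ.* x) ℤ.* 1ℤ ≡ 1ℤ ℤ.* (1ℤ ℤ.* x) ℤ.* (1ℤ ℤ.* 1ℤ) ℤ.+ 0ℤ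
  lemma = solve-∀
δ-expansion n i@(suc q) q<n = trans (ℤ.*-zeroʳ (fact n)) (sym (ℤ.*-cancelˡ-≡ (fact (2 * i)) _ 0ℤ (begin
  fact (2 * i) ℤ.* ∑< (suc n) (λ k → ε k ℤ.* d n k ℤ.* e n k i)
    ≡⟨ ∑<-* (suc n) (fact (2 * i)) (λ k → ε k ℤ.* d n k ℤ.* e n k i) ⟨
  ∑< (suc n) (λ k → fact (2 * i) ℤ.* (ε k ℤ.* d n k ℤ.* e n k i))
    ≡⟨ ∑<-cong (suc n) (λ { k (s≤s k≤n) → term k k≤n }) ⟩
  ∑< (suc n) (λ k → w ℤ.* (ε k ℤ.* b (2 * i) (i + k)))
    ≡⟨ ∑<-* (suc n) w (λ k → ε k ℤ.* b (2 * i) (i + k)) ⟩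
  w ℤ.* ∑< (suc n) (λ k → ε k ℤ.* b (2 * i) (i + k))
    ≡⟨ cong (w ℤ.*_) (ε-binomial-partialSum q n) ⟩
  w ℤ.* (+ 2 ℤ.* -1ℤ ℤ.^ n ℤ.* b (q + i) (i + n))
    -- With `i = q + 1 ≤ n`, the lower index `i + n` exceeds the row `q + i`.
    ≡⟨ cong (λ x → w ℤ.* (+ 2 ℤ.* -1ℤ ℤ.^ n ℤ.* x)) (b-zero (subst (_< i + n) (ℕ.+-comm i q) (ℕ.+-monoʳ-< i q<n))) ⟩
  w ℤ.* (+ 2 ℤ.* -1ℤ ℤ.^ n ℤ.* 0ℤ)
    ≡⟨ lemma₂ w (-1ℤ ℤ.^ n) (fact (2 * i)) ⟩
  fact (2 * i) ℤ.* 0ℤ ∎)))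
  where
  open ≡-Reasoning
  instance _ = ℕ._!≢0 (2 * i)
  w = fact i ℤ.* fact (n + i)
  lemma₁ : ∀ x y z w → x ℤ.* (y ℤ.* z ℤ.* w) ≡ y ℤ.* (x ℤ.* (z ℤ.* w))
  lemma₁ = solve-∀
  lemma₂ : ∀ x y z → x ℤ.* (+ 2 ℤ.* y ℤ.* 0ℤ) ≡ z ℤ.* 0ℤ
  lemma₂ = solve-∀
  lemma₃ : ∀ x y z → x ℤ.* (y ℤ.* z) ≡ y ℤ.* (x ℤ.* z)
  lemma₃ = solve-∀
  term : ∀ k → k ≤ n → fact (2 * i) ℤ.* (ε k ℤ.* d n k ℤ.* e n k i) ≡ w ℤ.* (ε k ℤ.* b (2 * i) (i + k))
  term k k≤n = trans (lemma₁ (fact (2 * i)) (ε k) (d n k) (e n k i))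
    (trans (cong (ε k ℤ.*_) (e-scaled n k i k≤n)) (lemma₃ (ε k) w (b (2 * i) (i + k))))

-- At `s = n` the eigenvector value is `e n k n = C(n,k) g(k)`: the factor `C(n,k)` turns `d n k`
-- into `n!`, and the extra `g(k)` raises the exponent from `r` to `suc r`.
alternatingSum-suc : ∀ n r → alternatingSum n (suc r) ≡ -1ℤ ℤ.^ n ℤ.* pow n r δ n
alternatingSum-suc n r = trans (alternatingSum-folded n (suc r)) (cong (-1ℤ ℤ.^ n ℤ.*_)
  (sym (ℤ.*-cancelˡ-≡ (fact n) _ _ (begin
  fact n ℤ.* pow n r δ n
    ≡⟨ pow-spectral n r (fact n) δ (λ k → ε k ℤ.* d n k) (δ-expansion n) n ℕ.≤-refl ⟩
  ∑< (suc n) (λ k → g n k ℤ.^ r ℤ.* (ε k ℤ.* d n k) ℤ.* e n k n)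
    ≡⟨ ∑<-cong (suc n) (λ { k (s≤s k≤n) → term k k≤n }) ⟩
  ∑< (suc n) (λ k → fact n ℤ.* (ε k ℤ.* g n k ℤ.^ suc r))
    ≡⟨ ∑<-* (suc n) (fact n) (λ k → ε k ℤ.* g n k ℤ.^ suc r) ⟩
  fact n ℤ.* ∑< (suc n) (λ k → ε k ℤ.* g n k ℤ.^ suc r) ∎))))
  where
  open ≡-Reasoning
  instance _ = ℕ._!≢0 n
  lemma₁ : ∀ x y k l z w → x ℤ.* (y ℤ.* (k ℤ.* l)) ℤ.* (z ℤ.* w) ≡ z ℤ.* (k ℤ.* l) ℤ.* (y ℤ.* (w ℤ.* x))
  lemma₁ = solve-∀
  term : ∀ k → k ≤ n → g n k ℤ.^ r ℤ.* (ε k ℤ.* d n k) ℤ.* e n k n ≡ fact n ℤ.* (ε k ℤ.* g n k ℤ.^ suc r)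
  term k k≤n = trans (lemma₁ (g n k ℤ.^ r) (ε k) (fact k) (fact (n ∸ k)) (b n k) (b (n + n) (k + n)))
    (cong₂ (λ x y → x ℤ.* (ε k ℤ.* (y ℤ.* g n k ℤ.^ r)))
      (b-factorial {k} {n ∸ k} (sym (ℕ.m+[n∸m]≡n k≤n)))
      (cong₂ b (sym (2*n≡n+n n)) (ℕ.+-comm k n)))

-- Extracting the central binomial coefficient

𝟏 : ℕ → ℤ
𝟏 _ = 1ℤ

-- Only column 0 contributes. The zero second summand puts the result in the shape that `pow-lin`
-- accepts.
Aδ : ∀ n s → A n δ s ≡ lin (b (2 * n) n) 𝟏 0ℤ 𝟏 s
Aδ n s = begin
  1ℤ ℤ.* (g n 0 ℤ.* 1ℤ) ℤ.+ ∑< n (λ t → b s (suc t) ℤ.* (g n (suc t) ℤ.* 0ℤ))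
    ≡⟨ cong (ℤ._+_ (1ℤ ℤ.* (g n 0 ℤ.* 1ℤ))) (∑<-zero n (λ t _ → zeros (b s (suc t)) (g n (suc t)))) ⟩
  1ℤ ℤ.* (g n 0 ℤ.* 1ℤ) ℤ.+ 0ℤ          ≡⟨ lemma (g n 0) ⟩
  g n 0 ℤ.* 1ℤ ℤ.+ 0ℤ ℤ.* 1ℤ            ≡⟨ cong (λ x → b (2 * n) x ℤ.* 1ℤ ℤ.+ 0ℤ ℤ.* 1ℤ) (ℕ.+-identityʳ n) ⟩
  b (2 * n) n ℤ.* 1ℤ ℤ.+ 0ℤ ℤ.* 1ℤ      ∎
  where
  open ≡-Reasoning
  zeros : ∀ x y → x ℤ.* (y ℤ.* 0ℤ) ≡ 0ℤ
  zeros = solve-∀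
  lemma : ∀ x → 1ℤ ℤ.* (x ℤ.* 1ℤ) ℤ.+ 0ℤ ≡ x ℤ.* 1ℤ ℤ.+ 0ℤ ℤ.* 1ℤ
  lemma = solve-∀

pow-δ : ∀ n r → pow n (suc r) δ n ≡ b (2 * n) n ℤ.* pow n r 𝟏 n
pow-δ n r = begin
  pow n r (A n δ) n                                    ≡⟨ pow-cong n r (λ t _ → Aδ n t) n ℕ.≤-refl ⟩
  pow n r (lin (b (2 * n) n) 𝟏 0ℤ 𝟏) n                 ≡⟨ pow-lin n r (b (2 * n) n) 𝟏 0ℤ 𝟏 n ℕ.≤-refl ⟩
  b (2 * n) n ℤ.* pow n r 𝟏 n ℤ.+ 0ℤ                   ≡⟨ ℤ.+-identityʳ _ ⟩
  b (2 * n) n ℤ.* pow n r 𝟏 n                          ∎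
  where open ≡-Reasoning

-- Ideals

record IsIdeal (I : ℤ → Set) : Set where
  field
    +-closed : ∀ {x y} → I x → I y → I (x ℤ.+ y)
    *-closed : ∀ c {x} → I x → I (c ℤ.* x)

primeDivisor : ∀ m → 1 < m → ∃[ p ] Prime p × p ℕ.∣ m
primeDivisor m@(suc _) 1<m with factorise m
... | record { factors = []     ; isFactorisation = m≡1 } = contradiction m≡1 (ℕ.>⇒≢ 1<m)
... | record { factors = p ∷ ps ; isFactorisation = m≡ ; factorsPrime = p-prime ∷ _ } =
  p , p-prime , ℕ.divides (product ps) (trans m≡ (ℕ.*-comm p (product ps)))

module _ {I : ℤ → Set} (ideal : IsIdeal I) where
  open IsIdeal ideal

  abs-closed : ∀ x → I x → I (+ ℤ.∣ x ∣)
  abs-closed (+ m)      x∈I = x∈I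
  abs-closed ℤ.-[1+ m ] x∈I = subst I (ℤ.-1*i≡-i ℤ.-[1+ m ]) (*-closed -1ℤ x∈I)

  -- The hypothesis has the subtraction-free form of a Bézout identity over ℕ; exchanging the roles
  -- of `u` and `v` covers both of its orientations.
  difference-closed : ∀ {k} x y {u v} → k + y * v ≡ x * u → I (+ u) → I (+ v) → I (+ k)
  difference-closed {k} x y {u} {v} eq u∈I v∈I =
    subst I (trans (cong (ℤ._+ ℤ.- (+ y) ℤ.* + v) xu≡) (lemma (+ k) (+ y) (+ v)))
      (+-closed (*-closed (+ x) u∈I) (*-closed (ℤ.- (+ y)) v∈I))
    where
    xu≡ : + x ℤ.* + u ≡ + k ℤ.+ + y ℤ.* + v
    xu≡ = trans (sym (ℤ.pos-* x u)) (trans (cong +_ (sym eq)) (cong (ℤ._+_ (+ k)) (ℤ.pos-* y v)))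
    lemma : ∀ k y v → k ℤ.+ y ℤ.* v ℤ.+ ℤ.- y ℤ.* v ≡ k
    lemma = solve-∀

  gcd-closed : ∀ u v → I (+ u) → I (+ v) → I (+ gcd u v)
  gcd-closed u v u∈I v∈I with Bézout.identity (gcd-GCD u v)
  ... | Bézout.+- x y eq = difference-closed x y eq u∈I v∈I
  ... | Bézout.-+ x y eq = difference-closed y x eq v∈I u∈I

  -- Descent on a positive `m` in the ideal: for a prime `p ∣ m` and a member `z` with `p ∤ z`, the
  -- gcd of `m` and `z` is again in the ideal and is a proper divisor of `m`.
  1∈ideal : (∀ p → Prime p → ∃[ y ] I y × ¬ + p ∣ y) → I 1ℤ
  -- The prime 2 is used only to obtain a nonzero member from which to start.
  1∈ideal avoid with avoid 2 prime[2]
  ... | y , y∈I , 2∤y = descend ℤ.∣ y ∣ (<-wellFounded _)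
    (λ y≡0 → 2∤y (∣ᵤ⇒∣ (subst (2 ℕ.∣_) (sym y≡0) (2 ℕ.∣0))))
    (abs-closed y y∈I)
    where
    descend : ∀ m → Acc _<_ m → m ≢ 0 → I (+ m) → I 1ℤ
    descend zero                _         m≢0 m∈I = contradiction refl m≢0
    descend (suc zero)          _         m≢0 m∈I = m∈I
    descend m@(suc (suc _)) (acc rec) m≢0 m∈I with primeDivisor m (s≤s (s≤s z≤n))
    ... | p , p-prime , p∣m with avoid p p-prime
    ...   | z , z∈I , p∤z = descend h (rec (ℕ.≤∧≢⇒< (ℕ.∣⇒≤ (gcd[m,n]∣m m ℤ.∣ z ∣)) h≢m))
                                    (gcd[m,n]≢0 m ℤ.∣ z ∣ (inj₁ m≢0)) (gcd-closed m ℤ.∣ z ∣ m∈I (abs-closed z z∈I))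
      where
      h = gcd m ℤ.∣ z ∣
      h≢m : h ≢ m
      h≢m h≡m = p∤z (∣ᵤ⇒∣ (ℕ.∣-trans p∣m (subst (ℕ._∣ ℤ.∣ z ∣) h≡m (gcd[m,n]∣n m ℤ.∣ z ∣))))

-- Elimination modulo a prime

prime-∤-* : ∀ {p} → Prime p → ∀ {x y} → ¬ + p ∣ x → ¬ + p ∣ y → ¬ + p ∣ x ℤ.* y
prime-∤-* {p} p-prime {x} {y} p∤x p∤y p∣xy
  with euclidsLemma ℤ.∣ x ∣ ℤ.∣ y ∣ p-prime (subst (p ℕ.∣_) (ℤ.abs-* x y) (∣⇒∣ᵤ p∣xy))
... | inj₁ p∣x = p∤x (∣ᵤ⇒∣ p∣x)
... | inj₂ p∣y = p∤y (∣ᵤ⇒∣ p∣y)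

prime-∤-1 : ∀ {p} → Prime p → ¬ + p ∣ 1ℤ
prime-∤-1 {p} p-prime p∣1 = ¬prime[1] (subst Prime (ℕ.∣1⇒≡1 (∣⇒∣ᵤ p∣1)) p-prime)

module _ {I : ℤ → Set} (ideal : IsIdeal I) (n : ℕ) {p : ℕ} (p-prime : Prime p) where
  open IsIdeal ideal

  -- The largest `A`-stable set of functions whose value at `n` lies in `I`.
  K : (ℕ → ℤ) → Set
  K f = ∀ j → I (pow n j f n)

  K-lin : ∀ x {f} y {h} → K f → K h → K (lin x f y h)
  K-lin x {f} y {h} Kf Kh j = subst I (sym (pow-lin n j x f y h n ℕ.≤-refl))
    (+-closed (*-closed x (Kf j)) (*-closed y (Kh j)))

  K-A : ∀ {f} → K f → K (A n f)
  K-A Kf j = Kf (suc j)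

  -- The congruence `c f ≡ h` modulo `p` on the coordinates where the diagonal of `A` is a unit. The
  -- scalar `c`, prime to `p` in all uses, stands in for division modulo `p`.
  Represents : (ℕ → ℤ) → ℤ → (ℕ → ℤ) → ℕ → Set
  Represents f c h t = ∀ i → i < t → ¬ + p ∣ g n i → + p ∣ c ℤ.* f i ℤ.- h i

  -- In row `i ≤ t`, terms with `k < t` vanish modulo `p` through `g n k` or `u k`, and those with
  -- `k > t` through `b i k`. The term `k = t` is `g n t * u t` if `i = t`; if `i < t`, it is zero
  -- and so is `u i` modulo `p`.
  A-leading : ∀ u t → t ≤ n → (∀ i → i < t → ¬ + p ∣ g n i → + p ∣ u i) →
              ∀ i → i ≤ t → ¬ + p ∣ g n i → + p ∣ A n u i ℤ.- g n t ℤ.* u i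
  A-leading u t t≤n p∣u i i≤t p∤gᵢ = subst (+ p ∣_) (lemma (A n u i) F[t] (g n t ℤ.* u i))
    (∣m∣n⇒∣m+n (∑<-∣-except (+ p) (suc n) t (s≤s t≤n) offDiagonal) diagonal)
    where
    F[t] = b i t ℤ.* (g n t ℤ.* u t)
    lemma : ∀ x y z → x ℤ.- y ℤ.+ (y ℤ.- z) ≡ x ℤ.- z
    lemma = solve-∀
    offDiagonal : ∀ k → k < suc n → k ≢ t → + p ∣ b i k ℤ.* (g n k ℤ.* u k)
    offDiagonal k _ k≢t with ℕ.<-cmp k t
    ... | tri≈ _ k≡t _ = contradiction k≡t k≢t
    ... | tri> _ _ t<k = subst (λ x → + p ∣ x ℤ.* (g n k ℤ.* u k)) (sym (b-zero (ℕ.≤-<-trans i≤t t<k))) (divides 0ℤ refl)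
    ... | tri< k<t _ _ with + p ∣? g n k
    ...   | yes p∣gₖ = ∣n⇒∣m*n (b i k) (∣m⇒∣m*n (u k) p∣gₖ)
    ...   | no  p∤gₖ = ∣n⇒∣m*n (b i k) (∣n⇒∣m*n (g n k) (p∣u k k<t p∤gₖ))
    diagonal : + p ∣ F[t] ℤ.- g n t ℤ.* u i
    diagonal with ℕ.m≤n⇒m<n∨m≡n i≤t
    ... | inj₂ refl = divides 0ℤ (trans
        (cong (λ x → x ℤ.* (g n t ℤ.* u t) ℤ.- g n t ℤ.* u t) (cong +_ (nCn≡1 t))) (cancel (g n t ℤ.* u t)))
      where
      cancel : ∀ x → 1ℤ ℤ.* x ℤ.- x ≡ 0ℤ
      cancel = solve-∀
    ... | inj₁ i<t = ∣m∣n⇒∣m-n (subst (λ x → + p ∣ x ℤ.* (g n t ℤ.* u t)) (sym (b-zero i<t)) (divides 0ℤ refl))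
                              (∣n⇒∣m*n (g n t) (p∣u i i<t p∤gᵢ))

  -- If c f - k vanishes mod p below t, then A - g(t) makes it vanish at t as well:
  -- the Cayley–Hamilton theorem for a triangular operator, one diagonal entry at a time.
  represent-up-to : ∀ f h c → ¬ + p ∣ c → K h → Represents (A n f) c h (suc n) → ∀ t → t ≤ suc n →
                    ∃[ c′ ] ∃[ k ] (¬ + p ∣ c′) × K k × Represents f c′ k t
  represent-up-to f h c p∤c Kh Af≈h zero t≤1+n = c , h , p∤c , Kh , λ _ ()
  represent-up-to f h c p∤c Kh Af≈h (suc t) (s≤s t≤n)
    with represent-up-to f h c p∤c Kh Af≈h t (ℕ.m≤n⇒m≤1+n t≤n)
  ... | c′ , k , p∤c′ , Kk , f≈k with + p ∣? g n t
  -- Here coordinate `t` is exempt from `Represents`, so the old witnesses still serve.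
  ...   | yes p∣gₜ = c′ , k , p∤c′ , Kk , extended
    where
    extended : Represents f c′ k (suc t)
    extended i (s≤s i≤t) p∤gᵢ with ℕ.m≤n⇒m<n∨m≡n i≤t
    ... | inj₁ i<t  = f≈k i i<t p∤gᵢ
    ... | inj₂ refl = contradiction p∣gₜ p∤gᵢ
  ...   | no p∤gₜ = c ℤ.* (g n t ℤ.* c′) , k′ , prime-∤-* p-prime p∤c (prime-∤-* p-prime p∤gₜ p∤c′)
                  , K-lin 1ℤ (ℤ.- c) (K-lin (c ℤ.* g n t) c′ Kk Kh) (K-A Kk) , extended
    where
    -- Multiply `(A - g(t)) (c′ f - k) ≡ 0` by `c`, replace `c A f` by `h`, and solve for
    -- `c g(t) c′ f`: the other side is `c g(t) k + c′ h - c A k`.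
    k′ = lin 1ℤ (lin (c ℤ.* g n t) k c′ h) (ℤ.- c) (A n k)
    u  = lin c′ f -1ℤ k
    u≡ : ∀ i → c′ ℤ.* f i ℤ.- k i ≡ u i
    u≡ i = cong (ℤ._+_ (c′ ℤ.* f i)) (sym (ℤ.-1*i≡-i (k i)))
    lemma : ∀ c c′ g Af Ak f k h →
      c′ ℤ.* (c ℤ.* Af ℤ.- h) ℤ.- c ℤ.* (c′ ℤ.* Af ℤ.+ -1ℤ ℤ.* Ak ℤ.- g ℤ.* (c′ ℤ.* f ℤ.+ -1ℤ ℤ.* k)) ≡
      c ℤ.* (g ℤ.* c′) ℤ.* f ℤ.- (1ℤ ℤ.* (c ℤ.* g ℤ.* k ℤ.+ c′ ℤ.* h) ℤ.+ ℤ.- c ℤ.* Ak)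
    lemma = solve-∀
    extended : Represents f (c ℤ.* (g n t ℤ.* c′)) k′ (suc t)
    extended i (s≤s i≤t) p∤gᵢ = subst (+ p ∣_)
      (lemma c c′ (g n t) (A n f i) (A n k i) (f i) (k i) (h i))
      (∣m∣n⇒∣m-n (∣n⇒∣m*n c′ (Af≈h i (s≤s (ℕ.≤-trans i≤t t≤n)) p∤gᵢ))
        (∣n⇒∣m*n c (subst (λ x → + p ∣ x ℤ.- g n t ℤ.* u i) (A-lin n c′ f -1ℤ k i)
          (A-leading u t t≤n (λ j j<t p∤gⱼ → subst (+ p ∣_) (u≡ j) (f≈k j j<t p∤gⱼ)) i i≤t p∤gᵢ))))

  -- One factor `A` is inverted modulo `p` per induction step, at the cost of a scalar prime to `p`.
  represent : ∀ M f → K (pow n M f) → ∃[ c ] ∃[ h ] (¬ + p ∣ c) × K h × Represents f c h (suc n)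
  represent zero    f Kf = 1ℤ , f , prime-∤-1 p-prime , Kf , λ i _ _ → divides 0ℤ (cancel (f i))
    where
    cancel : ∀ x → 1ℤ ℤ.* x ℤ.- x ≡ 0ℤ
    cancel = solve-∀
  represent (suc M) f KAᴹ⁺¹f with represent M (A n f) KAᴹ⁺¹f
  ... | c , h , p∤c , Kh , Af≈h = represent-up-to f h c p∤c Kh Af≈h (suc n) ℕ.≤-refl

  -- Coordinate `n` survives because `g n n = 1`, so `h n ≡ c` modulo `p`, while `Kh 0` says that
  -- `h n` is in `I`.
  prime-avoided : ∀ M → K (pow n M 𝟏) → ∃[ y ] I y × ¬ + p ∣ y
  prime-avoided M K𝟏 with represent M 𝟏 K𝟏
  ... | c , h , p∤c , Kh , 𝟏≈h = h n , Kh 0 , λ p∣hₙ → p∤c (subst (+ p ∣_) (lemma c (h n))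
          (∣m∣n⇒∣m+n (𝟏≈h n ℕ.≤-refl p∤gₙ) p∣hₙ))
    where
    lemma : ∀ c x → c ℤ.* 1ℤ ℤ.- x ℤ.+ x ≡ c
    lemma = solve-∀
    p∤gₙ : ¬ + p ∣ g n n
    p∤gₙ = subst (λ x → ¬ + p ∣ x) (cong +_ (sym (trans (cong (_C (n + n)) (2*n≡n+n n)) (nCn≡1 (n + n)))))
      (prime-∤-1 p-prime)

-- The colon ideal and the gcd

-- In the ideal quotient of `⟨ a ⟩` by `D`, the claim that `D` lies in `⟨ a ⟩` becomes membership of
-- 1.
colon-isIdeal : ∀ a D → IsIdeal (λ x → (D ℤ.* x) ∈⟨ a ⟩)
colon-isIdeal a D = record
  { +-closed = λ {x} {y} x∈ y∈ → subst (_∈⟨ a ⟩) (sym (ℤ.*-distribˡ-+ D x y)) (add x∈ y∈)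
  ; *-closed = λ c {x} x∈ → subst (_∈⟨ a ⟩) (lemma c D x) (scale c x∈)
  }
  where
  lemma : ∀ c D x → c ℤ.* (D ℤ.* x) ≡ D ℤ.* (c ℤ.* x)
  lemma = solve-∀

∈⇒∣ : ∀ {a D x} → (∀ i → D ∣ a i) → x ∈⟨ a ⟩ → D ∣ x
∈⇒∣ D∣a (generator i)     = D∣a i
∈⇒∣ D∣a _∈⟨_⟩.zero        = divides 0ℤ refl
∈⇒∣ D∣a (add x∈ y∈)       = ∣m∣n⇒∣m+n (∈⇒∣ D∣a x∈) (∈⇒∣ D∣a y∈)
∈⇒∣ D∣a (scale c x∈)      = ∣n⇒∣m*n c (∈⇒∣ D∣a x∈)

centralBinomial-∣ : ∀ n → .{{_ : NonZero n}} → ∀ r → b (2 * n) n ∣ alternatingSum n (suc r)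
centralBinomial-∣ n r = subst (b (2 * n) n ∣_) (sym (alternatingSum-suc n r)) (∣n⇒∣m*n (-1ℤ ℤ.^ n) (divisible n r))
  where
  divisible : ∀ n → .{{_ : NonZero n}} → ∀ r → b (2 * n) n ∣ pow n r δ n
  -- For exponent 1 the value is `δ n`, which is zero since `n` is positive.
  divisible (suc _) zero    = divides 0ℤ refl
  divisible n       (suc r) = subst (b (2 * n) n ∣_) (sym (pow-δ n r))
    (∣m⇒∣m*n (pow n r 𝟏 n) (divides 1ℤ (sym (ℤ.*-identityˡ _))))

-- The sign is its own inverse. Of the two extra exponents, one comes from `alternatingSum-suc` and
-- one from the application of `A` that turns `δ` into a multiple of `𝟏`.
centralBinomial*pow : ∀ n r → b (2 * n) n ℤ.* pow n r 𝟏 n ≡ -1ℤ ℤ.^ n ℤ.* alternatingSum n (2 + r)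
centralBinomial*pow n r = sym (begin
  σ ℤ.* alternatingSum n (2 + r)        ≡⟨ cong (σ ℤ.*_) (alternatingSum-suc n (suc r)) ⟩
  σ ℤ.* (σ ℤ.* pow n (suc r) δ n)       ≡⟨ ℤ.*-assoc σ σ _ ⟨
  σ ℤ.* σ ℤ.* pow n (suc r) δ n         ≡⟨ cong (ℤ._* pow n (suc r) δ n)
                                             (trans (sym (ℤ.^-distribˡ-+-* -1ℤ n n)) (-1^[k+k]≡1 n)) ⟩
  1ℤ ℤ.* pow n (suc r) δ n              ≡⟨ ℤ.*-identityˡ _ ⟩
  pow n (suc r) δ n                     ≡⟨ pow-δ n r ⟩
  b (2 * n) n ℤ.* pow n r 𝟏 n           ∎)
  where
  open ≡-Reasoning
  σ = -1ℤ ℤ.^ n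

mainTheorem3 : ∀ (m n : ℕ) → .{{_ : NonZero m}} → .{{_ : NonZero n}} →
    IsGCD (λ i → alternatingSum n (m + i)) ((2 * n) C n)
mainTheorem3 m@(suc m-1) n x = mk⇔ (∈⇒∣ (λ i → centralBinomial-∣ n (m-1 + i))) ∣⇒∈
  where
  a : ℕ → ℤ
  a i = alternatingSum n (m + i)
  D = b (2 * n) n
  ideal = colon-isIdeal a D
  -- Starting from the `m`-th iterate makes every exponent `2 + (m + j)` at least `m`, so the sum is
  -- generator `2 + j`.
  K𝟏 : ∀ j → (D ℤ.* pow n j (pow n m 𝟏) n) ∈⟨ a ⟩
  K𝟏 j = subst (_∈⟨ a ⟩) (sym (begin
    D ℤ.* pow n j (pow n m 𝟏) n               ≡⟨ cong (λ f → D ℤ.* f n) (pow-pow n m j 𝟏) ⟩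
    D ℤ.* pow n (m + j) 𝟏 n                   ≡⟨ centralBinomial*pow n (m + j) ⟩
    -1ℤ ℤ.^ n ℤ.* alternatingSum n (2 + (m + j)) ≡⟨ cong (λ k → -1ℤ ℤ.^ n ℤ.* alternatingSum n k) (shift m j) ⟩
    -1ℤ ℤ.^ n ℤ.* a (2 + j)                   ∎)) (scale (-1ℤ ℤ.^ n) (generator (2 + j)))
    where
    open ≡-Reasoning
    shift : ∀ m j → 2 + (m + j) ≡ m + (2 + j)
    shift = solveℕ-∀
  ∣⇒∈ : D ∣ x → x ∈⟨ a ⟩
  ∣⇒∈ (divides q x≡qD) = subst (_∈⟨ a ⟩) (sym (trans x≡qD (cong (q ℤ.*_) (sym (ℤ.*-identityʳ D)))))
    -- Membership of 1 in the colon ideal is `D * 1 ∈⟨ a ⟩`, which is then scaled by the quotient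
    -- `q`.
    (scale q (1∈ideal ideal (λ p p-prime → prime-avoided ideal n p-prime m K𝟏)))
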